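{- Let $\Phi$ be a finite irreducible crystallographic root system with simple system $\Pi$, and let $\alpha\in\Pi$. The number of roots in $\Phi_{\alpha,1}$ having the same length as $\alpha$ is $$\frac{|W_\alpha|}{|W_{\widetilde N[\alpha]}|}.$$
   Context: $\Phi$ is reduced, in a Euclidean space with Weyl-group-invariant form $(\cdot,\cdot)$. $\Phi_{\alpha,1}$ is the set of roots whose $\alpha$-coordinate with respect to $\Pi$ equals $1$. For $X\subseteq\Pi$, $W_X$ is the subgroup of the Weyl group generated by the reflections $s_\beta$ with $\beta\in\Pi\setminus X$; $W_\alpha=W_{\{\alpha\}}$. $\widetilde N[\alpha]=\{\varepsilon\in\Pi:(\varepsilon,\alpha)\ne0\}$, i.e. $\alpha$ together with its neighbours in the Dynkin diagram. -}

module Defs where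

open import Algebra.Bundles using (CommutativeRing; Monoid)
open import Algebra.Module.Bundles using (Module)
import Algebra.Definitions.RawMonoid as RawMonoidDefinitions
open import Data.Fin.Base using (Fin)
open import Data.Fin.Subset using (Subset; Nonempty; ∁) renaming (_∈_ to _∈ˢ_)
open import Data.Integer.Base using (ℤ; +_; -[1+_])
open import Data.Nat.Base as ℕ using (ℕ)
open import Data.Product.Base using (∃; _×_; proj₁)
open import Data.Sum.Base using (_⊎_)
open import Function.Base using (_∘_)
open import Function.Bundles using (Bijection; Func; _⟨$⟩_)
import Function.Construct.Composition as Composition
import Function.Construct.Identity as Identity
open import Function.Definitions using (StrictlyInverseˡ; StrictlyInverseʳ)
open import Function.Relation.Binary.Setoid.Equality using (_⇨_)
open import Level using (Level; _⊔_; suc; 0ℓ)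
open import Relation.Binary.Bundles using (Setoid)
open import Relation.Binary.Core using (Rel)
import Relation.Binary.Construct.On as On
open import Relation.Binary.PropositionalEquality.Core using (_≡_)
open import Relation.Binary.PropositionalEquality.Properties as ≡ using ()
open import Relation.Binary.Structures using (IsStrictTotalOrder)
open import Relation.Nullary.Negation.Core using (¬_)
open import Relation.Unary using (Pred; _∈_; _∉_)

------------------------------------------------------------------------
-- Cardinality

HasCardinality : ∀ {a ℓ} → Setoid a ℓ → ℕ → Set (a ⊔ ℓ)
HasCardinality S n = Bijection (≡.setoid (Fin n)) S

-- The subset of S cut out by P, with the equality of S: proofs of
-- membership are not compared.
subsetoid : ∀ {a ℓ p} (S : Setoid a ℓ) → Pred (Setoid.Carrier S) p →
            Setoid (a ⊔ p) ℓ
subsetoid S P = On.setoid S (proj₁ {B = P})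

------------------------------------------------------------------------
-- Scalars
--
-- The library has no real numbers, so the scalars are an arbitrary
-- totally ordered field; ℝ, with its classical order, is one.

record OrderedField (c ℓ₁ ℓ₂ : Level) : Set (suc (c ⊔ ℓ₁ ⊔ ℓ₂)) where
  field
    commutativeRing : CommutativeRing c ℓ₁

  open CommutativeRing commutativeRing public

  infix  4 _<_ _≤_
  infixl 8 _⁻¹

  field
    _<_                : Rel Carrier ℓ₂
    isStrictTotalOrder : IsStrictTotalOrder _≈_ _<_
    +-monoˡ-<          : ∀ z {x y} → x < y → x + z < y + z
    *-pos              : ∀ {x y} → 0# < x → 0# < y → 0# < x * y
    0#≉1#              : ¬ (0# ≈ 1#)
    -- A total operation whose value at 0# is unconstrained.
    _⁻¹                : Carrier → Carrier
    ⁻¹-inverseʳ        : ∀ x → ¬ (x ≈ 0#) → x * x ⁻¹ ≈ 1#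

  _≤_ : Rel Carrier (ℓ₁ ⊔ ℓ₂)
  x ≤ y = x < y ⊎ x ≈ y

  open RawMonoidDefinitions (Monoid.rawMonoid +-monoid)
    using () renaming (_×_ to _·_)

  fromℤ : ℤ → Carrier
  fromℤ (+ n)    = n · 1#
  fromℤ -[1+ n ] = - (ℕ.suc n · 1#)

------------------------------------------------------------------------
-- Euclidean spaces (finite-dimensionality is imposed by RootSystem.spans)

record EuclideanSpace {c ℓ₁ ℓ₂} (K : OrderedField c ℓ₁ ℓ₂) (v ℓv : Level)
                      : Set (c ⊔ ℓ₁ ⊔ ℓ₂ ⊔ suc (v ⊔ ℓv)) where
  open OrderedField K

  field
    vectorSpace : Module commutativeRing v ℓv

  open Module vectorSpace public

  field
    ⟨_,_⟩       : Carrierᴹ → Carrierᴹ → Carrier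
    ⟨,⟩-cong    : ∀ {x x′ y y′} → x ≈ᴹ x′ → y ≈ᴹ y′ → ⟨ x , y ⟩ ≈ ⟨ x′ , y′ ⟩
    ⟨,⟩-sym     : ∀ x y → ⟨ x , y ⟩ ≈ ⟨ y , x ⟩
    ⟨,⟩-+       : ∀ x y z → ⟨ x +ᴹ y , z ⟩ ≈ ⟨ x , z ⟩ + ⟨ y , z ⟩
    ⟨,⟩-*       : ∀ k x y → ⟨ k *ₗ x , y ⟩ ≈ k * ⟨ x , y ⟩
    ⟨,⟩-nonneg  : ∀ x → 0# ≤ ⟨ x , x ⟩
    ⟨,⟩-definite : ∀ x → ⟨ x , x ⟩ ≈ 0# → x ≈ᴹ 0ᴹ

  vectors : Setoid v ℓv
  vectors = record { isEquivalence = ≈ᴹ-isEquivalence }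

  lincomb : ∀ {n} → (Fin n → Carrier) → (Fin n → Carrierᴹ) → Carrierᴹ
  lincomb k x = sum (λ i → k i *ₗ x i)
    where open RawMonoidDefinitions +ᴹ-rawMonoid using (sum)

  -- 2⟨x,y⟩/⟨y,y⟩
  cartan : Carrierᴹ → Carrierᴹ → Carrier
  cartan x y = (1# + 1#) * ⟨ x , y ⟩ * ⟨ y , y ⟩ ⁻¹

  reflection : Carrierᴹ → Func vectors vectors
  reflection y = record
    { to   = λ x → x +ᴹ -ᴹ (cartan x y *ₗ y)
    ; cong = λ x≈x′ → +ᴹ-cong x≈x′ (-ᴹ‿cong (*ₗ-cong
        (*-cong (*-cong refl (⟨,⟩-cong x≈x′ ≈ᴹ-refl)) refl) ≈ᴹ-refl))
    }

module _ {c ℓ₁ ℓ₂ v ℓv} {K : OrderedField c ℓ₁ ℓ₂}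
         (E : EuclideanSpace K v ℓv) where
  open OrderedField K
  open EuclideanSpace E

  -- Finite, reduced, crystallographic.
  record RootSystem : Set (c ⊔ ℓ₁ ⊔ ℓ₂ ⊔ v ⊔ ℓv) where
    field
      size             : ℕ
      root             : Fin size → Carrierᴹ
      root-injective   : ∀ {i j} → root i ≈ᴹ root j → i ≡ j
      spans            : ∀ x → ∃ λ k → x ≈ᴹ lincomb k root
      nonzero          : ∀ i → ¬ (root i ≈ᴹ 0ᴹ)
      closed           : ∀ i j → ∃ λ k →
                         reflection (root i) ⟨$⟩ root j ≈ᴹ root k
      crystallographic : ∀ i j → ∃ λ z → cartan (root i) (root j) ≈ fromℤ z
      reduced          : ∀ i j k → root i ≈ᴹ k *ₗ root j → k ≈ 1# ⊎ k ≈ - 1#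

module _ {c ℓ₁ ℓ₂ v ℓv} {K : OrderedField c ℓ₁ ℓ₂}
         {E : EuclideanSpace K v ℓv} (Φ : RootSystem E) where
  open OrderedField K
  open EuclideanSpace E
  open RootSystem Φ

  -- Φ is nonempty and is not the union of two nonempty orthogonal subsets.
  Irreducible : Set ℓ₁
  Irreducible = Fin size × (∀ (S : Subset size) → Nonempty S → Nonempty (∁ S) →
    ¬ (∀ i j → i ∈ˢ S → j ∈ˢ ∁ S → ⟨ root i , root j ⟩ ≈ 0#))

  -- Roots are distinct for distinct indices, so counting indices counts roots.
  rootSubset : ∀ {p} → Pred (Fin size) p → Setoid p 0ℓ
  rootSubset = subsetoid (≡.setoid (Fin size))

  record SimpleSystem : Set (c ⊔ ℓ₁ ⊔ ℓ₂ ⊔ v ⊔ ℓv) where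
    field
      rank        : ℕ
      index       : Fin rank → Fin size

    simple : Fin rank → Carrierᴹ
    simple = root ∘ index

    field
      independent : ∀ k → lincomb k simple ≈ᴹ 0ᴹ → ∀ ε → k ε ≈ 0#
      coord       : Fin size → Fin rank → Carrier
      expansion   : ∀ i → root i ≈ᴹ lincomb (coord i) simple
      same-sign   : ∀ i → (∀ ε → 0# ≤ coord i ε) ⊎ (∀ ε → coord i ε ≤ 0#)

module _ {c ℓ₁ ℓ₂ v ℓv} {K : OrderedField c ℓ₁ ℓ₂}
         {E : EuclideanSpace K v ℓv} {Φ : RootSystem E}
         (Π : SimpleSystem Φ) where
  open OrderedField K
  open EuclideanSpace E
  open RootSystem Φ
  open SimpleSystem Π

  -- Membership in the subgroup of the group of bijections of E generated
  -- by the reflections in the simple roots outside X.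
  data Generated {p} (X : Pred (Fin rank) p)
                 : Pred (Func vectors vectors) (p ⊔ v ⊔ ℓv) where
    generator : ∀ {β} → β ∉ X → reflection (simple β) ∈ Generated X
    identity  : Identity.function vectors ∈ Generated X
    compose   : ∀ {f g} → f ∈ Generated X → g ∈ Generated X →
                Composition.function g f ∈ Generated X
    inverse   : ∀ {f g} → f ∈ Generated X →
                StrictlyInverseˡ _≈ᴹ_ (Func.to f) (Func.to g) →
                StrictlyInverseʳ _≈ᴹ_ (Func.to f) (Func.to g) →
                g ∈ Generated X

  W[_] : ∀ {p} → Pred (Fin rank) p → Setoid (p ⊔ v ⊔ ℓv) (v ⊔ ℓv)
  W[ X ] = subsetoid (vectors ⇨ vectors) (Generated X)

  Ñ[_] : Fin rank → Pred (Fin rank) ℓ₁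
  Ñ[ α ] ε = ¬ (⟨ simple ε , simple α ⟩ ≈ 0#)

  Φ[_,1] : Fin rank → Pred (Fin size) ℓ₁
  Φ[ α ,1] i = coord i α ≈ 1#

  -- Equal squared lengths; the ordered field need not have square roots.
  SameLength : Fin rank → Pred (Fin size) ℓ₁
  SameLength α i = ⟨ root i , root i ⟩ ≈ ⟨ simple α , simple α ⟩

{-# OPTIONS --safe #-}

-- W_α acts on the roots of Φ_{α,1} that are as long as α, and the formula is
-- the orbit-stabiliser theorem for α.
--
-- Transitivity: let γ be such a root. If (γ,β) > 0 for some simple β ≠ α, then
-- s_β lowers the height of γ. Otherwise γ - α is a nonnegative combination of
-- simple roots β ≠ α, so |γ - α|² = 2(γ - α,γ) ≤ 0 and γ = α.
--
-- Stabiliser: let w = u s_β be a word in the simple reflections other than s_α,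
-- with wα = α. If uβ < 0, the exchange condition yields a shorter word for w.
-- If uβ > 0, then (uβ,α) ≤ 0, whereas (uβ,α) = -(wβ,wα) = -(β,α) ≥ 0; so
-- (β,α) = 0, hence s_β and u both fix α, and one continues with u.
--
-- Finiteness of W_X: a word acts through a map on the finite set of roots, and
-- two suffixes inducing the same map can be exchanged to shorten the word, so
-- words of bounded length suffice and W_X can be enumerated.
module Submission where

open import Defs
open import Algebra.Bundles using (CommutativeMonoid)
import Algebra.Module.Properties as ModuleProperties
import Algebra.Properties.CommutativeSemigroup as CommutativeSemigroupProperties
import Algebra.Properties.Ring as RingProperties
import Algebra.Properties.Semiring.Sum as SemiringSum
import Algebra.Solver.CommutativeMonoid as CommutativeMonoidSolver
import Algebra.Solver.Ring.NaturalCoefficients.Default as SemiringSolver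
open import Data.Fin.Base as Fin using (Fin; zero; suc; toℕ; funToFin; finToFun)
open import Data.Fin.Induction using (spo-wellFounded)
import Data.Fin.Properties as Fin
open import Data.List.Base
  using ( List; []; _∷_; [_]; _++_; _∷ʳ_; length; lookup; take; drop; mapMaybe; deduplicate
        ; allFin; cartesianProductWith; initLast; _∷ʳ′_)
open import Data.List.Membership.Propositional using () renaming (_∈_ to _∈ˡ_)
open import Data.List.Membership.Propositional.Properties
  using (∈-lookup; ∈-allFin; ∈-cartesianProductWith⁺)
open import Data.List.Properties using (length-++; length-take; length-drop; take++drop≡id)
open import Data.List.Relation.Unary.All as All using (All; []; _∷_)
open import Data.List.Relation.Unary.All.Properties using (++⁺; take⁺; drop⁺; ∷ʳ⁺; ∷ʳ⁻)
open import Data.List.Relation.Unary.AllPairs using (_∷_)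
open import Data.List.Relation.Unary.Any as Any using (Any; here; there)
import Data.List.Relation.Unary.Any.Properties as Any
open import Data.List.Relation.Unary.Enumerates.Setoid.Properties
  using (deduplicate⁺; lookup-surjective)
open import Data.List.Relation.Unary.Unique.DecSetoid.Properties using (deduplicate-!)
open import Data.List.Relation.Unary.Unique.Setoid using (Unique)
open import Data.Maybe.Base as Maybe using (Maybe)
import Data.Maybe.Relation.Unary.Any as MaybeAny
open import Data.Nat.Base as ℕ using (ℕ)
import Data.Nat.Induction as ℕ
import Data.Nat.Properties as ℕ
open import Data.Product.Base using (∃; _×_; _,_; proj₁; proj₂; uncurry)
open import Data.Sum.Base using (_⊎_; inj₁; inj₂)
open import Data.Vec.Functional using (updateAt)
open import Data.Vec.Functional.Properties using (updateAt-updates; updateAt-minimal)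
open import Function.Base using (_∘_; const; id)
open import Function.Bundles using (Bijection; Func)
import Function.Construct.Composition as Composition
import Function.Construct.Identity as Identity
open import Function.Definitions using (Injective)
open import Induction.WellFounded using (Acc; acc; WellFounded)
open import Level using (Level; _⊔_)
open import Relation.Binary.Bundles using (Setoid)
open import Relation.Binary.Definitions
  using (tri<; tri≈; tri>) renaming (Decidable to Decidable₂)
open import Relation.Binary.PropositionalEquality.Core as ≡ using (_≡_; _≢_; _≗_)
import Relation.Binary.PropositionalEquality.Properties as ≡
import Relation.Binary.Reasoning.Setoid as ≈-Reasoning
open import Relation.Binary.Structures using (IsStrictTotalOrder)
open import Relation.Nullary.Decidable
  using (Dec; yes; no; dec⇒maybe; decidable-stable; map′; ¬?; _×-dec_)
open import Relation.Nullary.Negation using (¬_; contradiction)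
open import Relation.Unary using (Pred; Decidable; _∈_; _∉_; _∩_; _⊆_; ｛_｝)

-- Counting finite setoids

module _ {a ℓ} (S : Setoid a ℓ) where
  open Setoid S

  Unique⇒lookup-injective : ∀ {xs} → Unique S xs → Injective _≡_ _≈_ (lookup xs)
  Unique⇒lookup-injective (x∉ ∷ _) {zero}  {zero}  _  = ≡.refl
  Unique⇒lookup-injective (x∉ ∷ _) {zero}  {suc j} eq =
    contradiction eq (All.lookup x∉ (∈-lookup j))
  Unique⇒lookup-injective (x∉ ∷ _) {suc i} {zero}  eq =
    contradiction (sym eq) (All.lookup x∉ (∈-lookup i))
  Unique⇒lookup-injective (_ ∷ u)  {suc i} {suc j} eq =
    ≡.cong suc (Unique⇒lookup-injective u eq)

  -- The list `xs` holds codes, which `f` decodes partially and which together reach every class.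
  -- Deduplicating the decoded list leaves one representative per class, so looking up positions in
  -- it is the required bijection.
  finite : Decidable₂ _≈_ → ∀ {b} {B : Set b} (xs : List B) (f : B → Maybe Carrier) →
           (∀ s → Any (λ x → MaybeAny.Any (s ≈_) (f x)) xs) → ∃ (HasCardinality S)
  finite _≟_ xs f complete = length ys , record
    { to        = lookup ys
    ; cong      = λ { ≡.refl → refl }
    ; bijective = Unique⇒lookup-injective (deduplicate-! S? zs)
                , lookup-surjective S
                    (deduplicate⁺ S? (λ s → Any.mapMaybe⁺ f xs (Any.map⁺ (complete s))))
    }
    where
    S? = record { isDecEquivalence = record { isEquivalence = isEquivalence ; _≟_ = _≟_ } }
    zs = mapMaybe f xs
    ys = deduplicate _≟_ zs

  -- Meant for a group factored uniquely into coset representatives times stabiliser elements;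
  -- `combine` and `remQuot` identify pairs of indices with a single index.
  ×-cardinality : ∀ {m n} (f : Fin m → Fin n → Carrier) →
    (∀ {i i′ j j′} → f i j ≈ f i′ j′ → i ≡ i′ × j ≡ j′) →
    (∀ s → ∃ λ i → ∃ λ j → f i j ≈ s) →
    HasCardinality S (m ℕ.* n)
  ×-cardinality {m} {n} f inj surj = record
    { to        = g
    ; cong      = λ { ≡.refl → refl }
    ; bijective = g-injective
                , λ s → let i , j , fij≈s = surj s in Fin.combine i j ,
                    λ { ≡.refl → trans (reflexive (≡.cong (uncurry f) (Fin.remQuot-combine i j)))
                                       fij≈s }
    }
    where
    g : Fin (m ℕ.* n) → Carrier
    g = uncurry f ∘ Fin.remQuot n

    g-injective : Injective _≡_ _≈_ g
    g-injective {k} {k′} eq = let i≡i′ , j≡j′ = inj eq in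
      ≡.trans (≡.sym (Fin.combine-remQuot {m} n k))
        (≡.trans (≡.cong₂ Fin.combine i≡i′ j≡j′) (Fin.combine-remQuot {m} n k′))

-- The decision procedure may return a proof other than the given one, so `P` has to hold at every
-- proof.
dec⇒maybe-any : ∀ {a b p} {A : Set a} {B : Set b} {P : Pred B p} (f : A → B)
                (d : Dec A) → A → (∀ a → P (f a)) →
                MaybeAny.Any P (Maybe.map f (dec⇒maybe d))
dec⇒maybe-any f (yes a) _ p = MaybeAny.just (p a)
dec⇒maybe-any f (no ¬a) a _ = contradiction a ¬a

finite-subset : ∀ {n p} {P : Pred (Fin n) p} → Decidable P →
                ∃ (HasCardinality (subsetoid (≡.setoid (Fin n)) P))
finite-subset {n} {P = P} P? = finite _ (λ i j → proj₁ i Fin.≟ proj₁ j) (allFin n)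
  (λ i → Maybe.map (i ,_) (dec⇒maybe (P? i)))
  λ (i , pi) → Any.map (λ { ≡.refl → dec⇒maybe-any (i ,_) (P? i) pi (λ _ → ≡.refl) })
                       (∈-allFin i)

-- Enumeration of words of bounded length

length-∷ʳ : ∀ {a} {A : Set a} (xs : List A) x → length xs ℕ.< length (xs ∷ʳ x)
length-∷ʳ xs x = ℕ.≤-reflexive (≡.sym (≡.trans (length-++ xs) (ℕ.+-comm (length xs) 1)))

-- The empty word is added at every stage, so the words listed have length at most `n`, not exactly
-- `n`.
words : ∀ {a} {A : Set a} → ℕ → List A → List (List A)
words ℕ.zero    as = [ [] ]
words (ℕ.suc n) as = [] ∷ cartesianProductWith _∷_ as (words n as)

∈-words : ∀ {a} {A : Set a} {as : List A} → (∀ x → x ∈ˡ as) →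
          ∀ {n} l → length l ℕ.≤ n → l ∈ˡ words n as
∈-words all {ℕ.zero}  []      _          = here ≡.refl
∈-words all {ℕ.suc n} []      _          = here ≡.refl
∈-words all {ℕ.suc n} (x ∷ l) (ℕ.s≤s l≤n) =
  there (∈-cartesianProductWith⁺ _∷_ (all x) (∈-words all l l≤n))

-- Ordered field arithmetic

module OrderedFieldProperties {c ℓ₁ ℓ₂} (K : OrderedField c ℓ₁ ℓ₂) where
  open OrderedField K hiding (zero)
  open IsStrictTotalOrder isStrictTotalOrder public
    using (compare; _≟_; _<?_; irrefl; asym; <-respˡ-≈; <-respʳ-≈)
    renaming (trans to <-trans)
  open RingProperties ring public
    using (-‿distribˡ-*; -‿distribʳ-*; -‿involutive; -0#≈0#; -‿+-comm)
  open SemiringSum semiring public using (sum; sum-cong-≋)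

  ≤-respˡ-≈ : ∀ {x y z} → x ≈ y → x ≤ z → y ≤ z
  ≤-respˡ-≈ x≈y (inj₁ x<z) = inj₁ (<-respˡ-≈ x≈y x<z)
  ≤-respˡ-≈ x≈y (inj₂ x≈z) = inj₂ (trans (sym x≈y) x≈z)

  ≤-respʳ-≈ : ∀ {x y z} → x ≈ y → z ≤ x → z ≤ y
  ≤-respʳ-≈ x≈y (inj₁ z<x) = inj₁ (<-respʳ-≈ x≈y z<x)
  ≤-respʳ-≈ x≈y (inj₂ z≈x) = inj₂ (trans z≈x x≈y)

  ≤-trans : ∀ {x y z} → x ≤ y → y ≤ z → x ≤ z
  ≤-trans (inj₁ x<y) (inj₁ y<z) = inj₁ (<-trans x<y y<z)
  ≤-trans (inj₁ x<y) (inj₂ y≈z) = inj₁ (<-respʳ-≈ y≈z x<y)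
  ≤-trans (inj₂ x≈y) y≤z        = ≤-respˡ-≈ (sym x≈y) y≤z

  ≤⇒≯ : ∀ {x y} → x ≤ y → ¬ (y < x)
  ≤⇒≯ (inj₁ x<y) = asym x<y
  ≤⇒≯ (inj₂ x≈y) = irrefl (sym x≈y)

  ≯⇒≤ : ∀ {x y} → ¬ (y < x) → x ≤ y
  ≯⇒≤ {x} {y} y≮x with compare x y
  ... | tri< x<y _ _ = inj₁ x<y
  ... | tri≈ _ x≈y _ = inj₂ x≈y
  ... | tri> _ _ y<x = contradiction y<x y≮x

  ≤-antisym : ∀ {x y} → x ≤ y → y ≤ x → x ≈ y
  ≤-antisym (inj₂ x≈y) _   = x≈y
  ≤-antisym (inj₁ x<y) y≤x = contradiction x<y (≤⇒≯ y≤x)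

  +-nonpos : ∀ {x y} → x ≤ 0# → y ≤ 0# → x + y ≤ 0#
  +-nonpos (inj₁ x<0) y≤0 = ≤-trans (inj₁ (<-respʳ-≈ (+-identityˡ _) (+-monoˡ-< _ x<0))) y≤0
  +-nonpos (inj₂ x≈0) y≤0 = ≤-respˡ-≈ (sym (trans (+-congʳ x≈0) (+-identityˡ _))) y≤0

  sum-nonpos : ∀ {n} (f : Fin n → Carrier) → (∀ i → f i ≤ 0#) → sum f ≤ 0#
  sum-nonpos {ℕ.zero}  f f≤0 = inj₂ refl
  sum-nonpos {ℕ.suc n} f f≤0 = +-nonpos (f≤0 zero) (sum-nonpos (f ∘ suc) (f≤0 ∘ suc))

  pos⇒-neg : ∀ {x} → 0# < x → - x < 0#
  pos⇒-neg 0<x = <-respˡ-≈ (+-identityˡ _) (<-respʳ-≈ (-‿inverseʳ _) (+-monoˡ-< _ 0<x))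

  neg⇒-pos : ∀ {x} → x < 0# → 0# < - x
  neg⇒-pos x<0 = <-respʳ-≈ (+-identityˡ _) (<-respˡ-≈ (-‿inverseʳ _) (+-monoˡ-< _ x<0))

  -pos⇒neg : ∀ {x} → 0# < - x → x < 0#
  -pos⇒neg 0<-x = <-respˡ-≈ (-‿involutive _) (pos⇒-neg 0<-x)

  *-pos-neg : ∀ {x y} → 0# < x → y < 0# → x * y < 0#
  *-pos-neg 0<x y<0 =
    -pos⇒neg (<-respʳ-≈ (sym (-‿distribʳ-* _ _)) (*-pos 0<x (neg⇒-pos y<0)))

  *-nonneg-nonpos : ∀ {x y} → 0# ≤ x → y ≤ 0# → x * y ≤ 0#
  *-nonneg-nonpos (inj₁ 0<x) (inj₁ y<0) = inj₁ (*-pos-neg 0<x y<0)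
  *-nonneg-nonpos (inj₂ 0≈x) _          = inj₂ (trans (*-congʳ (sym 0≈x)) (zeroˡ _))
  *-nonneg-nonpos (inj₁ _)   (inj₂ y≈0) = inj₂ (trans (*-congˡ y≈0) (zeroʳ _))

  -- If 1 were negative, the product of -1 with itself, which is 1, would be positive.
  0<1 : 0# < 1#
  0<1 with compare 0# 1#
  ... | tri< 0<1 _ _ = 0<1
  ... | tri≈ _ 0≈1 _ = contradiction 0≈1 0#≉1#
  ... | tri> _ _ 1<0 = contradiction
    (<-respʳ-≈ (trans (sym (-‿distribˡ-* _ _)) (trans (-‿cong (*-identityˡ _)) (-‿involutive _)))
               (*-pos (neg⇒-pos 1<0) (neg⇒-pos 1<0)))
    (asym 1<0)

  0<1+1 : 0# < 1# + 1#
  0<1+1 = <-trans 0<1 (<-respˡ-≈ (+-identityˡ _) (+-monoˡ-< 1# 0<1))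

  1≰0 : ¬ (1# ≤ 0#)
  1≰0 1≤0 = ≤⇒≯ 1≤0 0<1

  ⁻¹-pos : ∀ {x} → 0# < x → 0# < x ⁻¹
  ⁻¹-pos {x} 0<x with compare 0# (x ⁻¹)
  ... | tri< 0<x⁻¹ _ _ = 0<x⁻¹
  ... | tri≈ _ 0≈x⁻¹ _ = contradiction
    (trans (sym (trans (*-congˡ (sym 0≈x⁻¹)) (zeroʳ x)))
           (⁻¹-inverseʳ x (λ x≈0 → irrefl (sym x≈0) 0<x)))
    0#≉1#
  ... | tri> _ _ x⁻¹<0 = contradiction
    (inj₁ (<-respˡ-≈ (⁻¹-inverseʳ x (λ x≈0 → irrefl (sym x≈0) 0<x)) (*-pos-neg 0<x x⁻¹<0)))
    1≰0

  -- The axioms do not make `_⁻¹` respect equality; away from zero this follows from uniqueness of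
  -- inverses.
  ⁻¹-cong : ∀ {x y} → ¬ (x ≈ 0#) → x ≈ y → x ⁻¹ ≈ y ⁻¹
  ⁻¹-cong {x} {y} x≉0 x≈y = begin
    x ⁻¹              ≈⟨ *-identityʳ _ ⟨
    x ⁻¹ * 1#         ≈⟨ *-congˡ (⁻¹-inverseʳ y (x≉0 ∘ trans x≈y)) ⟨
    x ⁻¹ * (y * y ⁻¹) ≈⟨ *-assoc _ _ _ ⟨
    x ⁻¹ * y * y ⁻¹   ≈⟨ *-congʳ (trans (*-comm _ _) (*-congʳ (sym x≈y))) ⟩
    x * x ⁻¹ * y ⁻¹   ≈⟨ *-congʳ (⁻¹-inverseʳ x x≉0) ⟩
    1# * y ⁻¹         ≈⟨ *-identityˡ _ ⟩
    y ⁻¹              ∎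
    where open ≈-Reasoning setoid

  x≤0∧y≤0∧x+y≈0⇒x≈0 : ∀ {x y} → x ≤ 0# → y ≤ 0# → x + y ≈ 0# → x ≈ 0#
  x≤0∧y≤0∧x+y≈0⇒x≈0 {x} {y} x≤0 y≤0 x+y≈0 with x≤0
  ... | inj₂ x≈0 = x≈0
  ... | inj₁ x<0 = contradiction
    (<-respʳ-≈ (+-identityˡ y) (<-respˡ-≈ x+y≈0 (+-monoˡ-< y x<0))) (≤⇒≯ y≤0)

-- Bilinear form, linear combinations and linear maps

module EuclideanProperties {c ℓ₁ ℓ₂ v ℓv} {K : OrderedField c ℓ₁ ℓ₂}
                           (E : EuclideanSpace K v ℓv) where
  open OrderedField K hiding (zero)
  open OrderedFieldProperties K
  open EuclideanSpace E
  open ModuleProperties vectorSpace public using (inverseˡ-uniqueᴹ)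

  -ᴹ‿distribˡ-*ₗ : ∀ k x → -ᴹ (k *ₗ x) ≈ᴹ (- k) *ₗ x
  -ᴹ‿distribˡ-*ₗ k x = ≈ᴹ-sym (inverseˡ-uniqueᴹ _ _ (begin
    - k *ₗ x +ᴹ k *ₗ x ≈⟨ *ₗ-distribʳ x (- k) k ⟨
    (- k + k) *ₗ x     ≈⟨ *ₗ-congʳ (-‿inverseˡ k) ⟩
    0# *ₗ x            ≈⟨ *ₗ-zeroˡ x ⟩
    0ᴹ                 ∎))
    where open ≈-Reasoning vectors

  +ᴹ-interchange : ∀ x y z w → (x +ᴹ y) +ᴹ (z +ᴹ w) ≈ᴹ (x +ᴹ z) +ᴹ (y +ᴹ w)
  +ᴹ-interchange = solve 4 (λ x y z w → (x ⊕ y) ⊕ (z ⊕ w) ⊜ (x ⊕ z) ⊕ (y ⊕ w)) ≈ᴹ-refl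
    where open CommutativeMonoidSolver +ᴹ-commutativeMonoid

  ⟨,⟩-congˡ : ∀ {x y z} → y ≈ᴹ z → ⟨ x , y ⟩ ≈ ⟨ x , z ⟩
  ⟨,⟩-congˡ = ⟨,⟩-cong ≈ᴹ-refl

  ⟨,⟩-congʳ : ∀ {x y z} → y ≈ᴹ z → ⟨ y , x ⟩ ≈ ⟨ z , x ⟩
  ⟨,⟩-congʳ y≈z = ⟨,⟩-cong y≈z ≈ᴹ-refl

  ⟨,⟩-+ʳ : ∀ x y z → ⟨ x , y +ᴹ z ⟩ ≈ ⟨ x , y ⟩ + ⟨ x , z ⟩
  ⟨,⟩-+ʳ x y z = trans (⟨,⟩-sym _ _) (trans (⟨,⟩-+ y z x) (+-cong (⟨,⟩-sym _ _) (⟨,⟩-sym _ _)))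

  ⟨,⟩-*ʳ : ∀ k x y → ⟨ x , k *ₗ y ⟩ ≈ k * ⟨ x , y ⟩
  ⟨,⟩-*ʳ k x y = trans (⟨,⟩-sym _ _) (trans (⟨,⟩-* k y x) (*-congˡ (⟨,⟩-sym _ _)))

  ⟨,⟩-zeroˡ : ∀ x → ⟨ 0ᴹ , x ⟩ ≈ 0#
  ⟨,⟩-zeroˡ x = trans (⟨,⟩-congʳ (≈ᴹ-sym (*ₗ-zeroˡ 0ᴹ))) (trans (⟨,⟩-* 0# 0ᴹ x) (zeroˡ _))

  ⟨,⟩-lincomb : ∀ {n} (k : Fin n → Carrier) x y →
                ⟨ lincomb k x , y ⟩ ≈ sum (λ i → k i * ⟨ x i , y ⟩)
  ⟨,⟩-lincomb {ℕ.zero}  k x y = ⟨,⟩-zeroˡ y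
  ⟨,⟩-lincomb {ℕ.suc n} k x y = trans (⟨,⟩-+ _ _ y)
    (+-cong (⟨,⟩-* _ _ y) (⟨,⟩-lincomb (k ∘ suc) (x ∘ suc) y))

  ⟨,⟩-pos : ∀ {x} → ¬ (x ≈ᴹ 0ᴹ) → 0# < ⟨ x , x ⟩
  ⟨,⟩-pos {x} x≉0 with ⟨,⟩-nonneg x
  ... | inj₁ 0<xx = 0<xx
  ... | inj₂ 0≈xx = contradiction (⟨,⟩-definite x (sym 0≈xx)) x≉0

  lincomb-cong : ∀ {n} {k l : Fin n → Carrier} {x y} → (∀ i → k i ≈ l i) →
                 (∀ i → x i ≈ᴹ y i) → lincomb k x ≈ᴹ lincomb l y
  lincomb-cong {ℕ.zero}  k≈l x≈y = ≈ᴹ-refl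
  lincomb-cong {ℕ.suc n} k≈l x≈y =
    +ᴹ-cong (*ₗ-cong (k≈l zero) (x≈y zero)) (lincomb-cong (k≈l ∘ suc) (x≈y ∘ suc))

  lincomb-+ : ∀ {n} (k l : Fin n → Carrier) x →
              lincomb (λ i → k i + l i) x ≈ᴹ lincomb k x +ᴹ lincomb l x
  lincomb-+ {ℕ.zero}  k l x = ≈ᴹ-sym (+ᴹ-identityˡ _)
  lincomb-+ {ℕ.suc n} k l x = ≈ᴹ-trans
    (+ᴹ-cong (*ₗ-distribʳ _ _ _) (lincomb-+ (k ∘ suc) (l ∘ suc) (x ∘ suc)))
    (+ᴹ-interchange _ _ _ _)

  lincomb-* : ∀ {n} a (k : Fin n → Carrier) x →
              lincomb (λ i → a * k i) x ≈ᴹ a *ₗ lincomb k x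
  lincomb-* {ℕ.zero}  a k x = ≈ᴹ-sym (*ₗ-zeroʳ a)
  lincomb-* {ℕ.suc n} a k x = ≈ᴹ-trans
    (+ᴹ-cong (*ₗ-assoc _ _ _) (lincomb-* a (k ∘ suc) (x ∘ suc))) (≈ᴹ-sym (*ₗ-distribˡ _ _ _))

  lincomb-zero : ∀ {n} (x : Fin n → Carrierᴹ) → lincomb (const 0#) x ≈ᴹ 0ᴹ
  lincomb-zero {ℕ.zero}  x = ≈ᴹ-refl
  lincomb-zero {ℕ.suc n} x = ≈ᴹ-trans
    (+ᴹ-cong (*ₗ-zeroˡ _) (lincomb-zero (x ∘ suc))) (+ᴹ-identityˡ _)

  -- A simple reflection adds a multiple of one simple root. This lemma turns that into a change of
  -- a single coordinate, and `sum-updateAt` into a change of height.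
  lincomb-updateAt : ∀ {n} (k : Fin n → Carrier) (x : Fin n → Carrierᴹ) i a →
                     lincomb (updateAt k i (_+ a)) x ≈ᴹ lincomb k x +ᴹ a *ₗ x i
  lincomb-updateAt {ℕ.suc n} k x zero a = ≈ᴹ-trans (+ᴹ-congʳ (*ₗ-distribʳ _ _ _))
    (xy∙z≈xz∙y _ _ _)
    where
    open CommutativeSemigroupProperties (CommutativeMonoid.commutativeSemigroup +ᴹ-commutativeMonoid)
  lincomb-updateAt {ℕ.suc n} k x (suc i) a = ≈ᴹ-trans
    (+ᴹ-congˡ (lincomb-updateAt (k ∘ suc) (x ∘ suc) i a)) (≈ᴹ-sym (+ᴹ-assoc _ _ _))

  sum-updateAt : ∀ {n} (k : Fin n → Carrier) i a → sum (updateAt k i (_+ a)) ≈ sum k + a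
  sum-updateAt {ℕ.suc n} k zero    a = xy∙z≈xz∙y _ _ _
    where open CommutativeSemigroupProperties +-commutativeSemigroup
  sum-updateAt {ℕ.suc n} k (suc i) a =
    trans (+-congˡ (sum-updateAt (k ∘ suc) i a)) (sym (+-assoc _ _ _))

  record Linear (f : Carrierᴹ → Carrierᴹ) : Set (c ⊔ v ⊔ ℓv) where
    field
      cong   : ∀ {x y} → x ≈ᴹ y → f x ≈ᴹ f y
      +-homo : ∀ x y → f (x +ᴹ y) ≈ᴹ f x +ᴹ f y
      *-homo : ∀ k x → f (k *ₗ x) ≈ᴹ k *ₗ f x

    0-homo : f 0ᴹ ≈ᴹ 0ᴹ
    0-homo = ≈ᴹ-trans (cong (≈ᴹ-sym (*ₗ-zeroˡ 0ᴹ))) (≈ᴹ-trans (*-homo _ _) (*ₗ-zeroˡ _))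

    lincomb-homo : ∀ {n} (k : Fin n → Carrier) x → f (lincomb k x) ≈ᴹ lincomb k (f ∘ x)
    lincomb-homo {ℕ.zero}  k x = 0-homo
    lincomb-homo {ℕ.suc n} k x = ≈ᴹ-trans (+-homo _ _)
      (+ᴹ-cong (*-homo _ _) (lincomb-homo (k ∘ suc) (x ∘ suc)))

  -- Reflections as linear isometric involutions

  module Reflection (y : Carrierᴹ) (y≉0 : ¬ (y ≈ᴹ 0ᴹ)) where

    s : Carrierᴹ → Carrierᴹ
    s = Func.to (reflection y)

    -- With the sign absorbed in the coefficient, the reflection becomes the sum `x +ᴹ μ x *ₗ y`,
    -- and later identities fall within reach of a semiring solver.
    μ : Carrierᴹ → Carrier
    μ x = - cartan x y

    0<yy : 0# < ⟨ y , y ⟩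
    0<yy = ⟨,⟩-pos y≉0

    yy≉0 : ¬ (⟨ y , y ⟩ ≈ 0#)
    yy≉0 yy≈0 = irrefl (sym yy≈0) 0<yy

    s-def : ∀ x → s x ≈ᴹ x +ᴹ μ x *ₗ y
    s-def x = +ᴹ-congˡ (-ᴹ‿distribˡ-*ₗ _ _)

    μ-+ : ∀ x z → μ (x +ᴹ z) ≈ μ x + μ z
    μ-+ x z = trans (-‿cong (trans (*-congʳ (trans (*-congˡ (⟨,⟩-+ x z y)) (distribˡ _ _ _)))
      (distribʳ _ _ _))) (sym (-‿+-comm _ _))

    μ-* : ∀ k x → μ (k *ₗ x) ≈ k * μ x
    μ-* k x = trans (-‿cong (trans (*-congʳ (*-congˡ (⟨,⟩-* k x y)))
      (solve 4 (λ t k p q → t :* (k :* p) :* q := k :* (t :* p :* q)) refl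
        (1# + 1#) k ⟨ x , y ⟩ (⟨ y , y ⟩ ⁻¹)))) (-‿distribʳ-* _ _)
      where open SemiringSolver commutativeSemiring

    -- This expresses that `x` and `s x` have opposite products with `y`. Both the isometry property
    -- and the stabiliser argument rest on it.
    μ-norm : ∀ x → ⟨ x , y ⟩ + ⟨ x , y ⟩ + μ x * ⟨ y , y ⟩ ≈ 0#
    μ-norm x = begin
      p + p + - (t * p * q ⁻¹) * q ≈⟨ +-congˡ (-‿distribˡ-* _ _) ⟨
      p + p - t * p * q ⁻¹ * q     ≈⟨ +-congˡ (-‿cong (trans (*-assoc _ _ _) (trans
                                        (*-congˡ (trans (*-comm _ _) (⁻¹-inverseʳ q yy≉0)))
                                        (*-identityʳ _)))) ⟩
      p + p - t * p                ≈⟨ +-congˡ (-‿cong (trans (distribʳ p 1# 1#)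
                                        (+-cong (*-identityˡ p) (*-identityˡ p)))) ⟩
      p + p - (p + p)              ≈⟨ -‿inverseʳ _ ⟩
      0#                           ∎
      where
      open ≈-Reasoning setoid
      p = ⟨ x , y ⟩
      q = ⟨ y , y ⟩
      t = 1# + 1#

    -- Both sides equal -2(x,y)(z,y)/(y,y), which is symmetric in `x` and `z`.
    μ-comm : ∀ x z → μ x * ⟨ z , y ⟩ ≈ μ z * ⟨ x , y ⟩
    μ-comm x z = trans (sym (-‿distribˡ-* _ _)) (trans (-‿cong
      (solve 4 (λ t p q r → t :* p :* q :* r := t :* r :* q :* p) refl
        (1# + 1#) ⟨ x , y ⟩ (⟨ y , y ⟩ ⁻¹) ⟨ z , y ⟩)) (-‿distribˡ-* _ _))
      where open SemiringSolver commutativeSemiring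

    μ-pos⇒neg : ∀ {x} → 0# < ⟨ x , y ⟩ → μ x < 0#
    μ-pos⇒neg 0<xy = pos⇒-neg (*-pos (*-pos 0<1+1 0<xy) (⁻¹-pos 0<yy))

    s-linear : Linear s
    s-linear = record
      { cong   = Func.cong (reflection y)
      ; +-homo = λ x z → begin
          s (x +ᴹ z)                             ≈⟨ s-def _ ⟩
          (x +ᴹ z) +ᴹ μ (x +ᴹ z) *ₗ y            ≈⟨ +ᴹ-congˡ (*ₗ-congʳ (μ-+ x z)) ⟩
          (x +ᴹ z) +ᴹ (μ x + μ z) *ₗ y           ≈⟨ +ᴹ-congˡ (*ₗ-distribʳ _ _ _) ⟩
          (x +ᴹ z) +ᴹ (μ x *ₗ y +ᴹ μ z *ₗ y)     ≈⟨ +ᴹ-interchange _ _ _ _ ⟩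
          (x +ᴹ μ x *ₗ y) +ᴹ (z +ᴹ μ z *ₗ y)     ≈⟨ +ᴹ-cong (s-def x) (s-def z) ⟨
          s x +ᴹ s z                             ∎
      ; *-homo = λ k x → begin
          s (k *ₗ x)                             ≈⟨ s-def _ ⟩
          k *ₗ x +ᴹ μ (k *ₗ x) *ₗ y              ≈⟨ +ᴹ-congˡ (*ₗ-congʳ (μ-* k x)) ⟩
          k *ₗ x +ᴹ (k * μ x) *ₗ y               ≈⟨ +ᴹ-congˡ (*ₗ-assoc _ _ _) ⟩
          k *ₗ x +ᴹ k *ₗ (μ x *ₗ y)              ≈⟨ *ₗ-distribˡ _ _ _ ⟨
          k *ₗ (x +ᴹ μ x *ₗ y)                   ≈⟨ *ₗ-congˡ (s-def x) ⟨
          k *ₗ s x                               ∎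
      }
      where open ≈-Reasoning vectors

    s-isometry : ∀ x z → ⟨ s x , s z ⟩ ≈ ⟨ x , z ⟩
    s-isometry x z = begin
      ⟨ s x , s z ⟩
        ≈⟨ ⟨,⟩-cong (s-def x) (s-def z) ⟩
      ⟨ x +ᴹ a *ₗ y , z +ᴹ b *ₗ y ⟩
        ≈⟨ ⟨,⟩-+ _ _ _ ⟩
      ⟨ x , z +ᴹ b *ₗ y ⟩ + ⟨ a *ₗ y , z +ᴹ b *ₗ y ⟩
        ≈⟨ +-cong (trans (⟨,⟩-+ʳ _ _ _) (+-congˡ (⟨,⟩-*ʳ _ _ _)))
             (trans (⟨,⟩-* _ _ _) (*-congˡ (trans (⟨,⟩-+ʳ _ _ _)
               (+-cong (⟨,⟩-sym _ _) (⟨,⟩-*ʳ _ _ _))))) ⟩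
      (⟨ x , z ⟩ + b * ⟨ x , y ⟩) + a * (⟨ z , y ⟩ + b * ⟨ y , y ⟩)
        ≈⟨ +-congˡ (distribˡ _ _ _) ⟩
      (⟨ x , z ⟩ + b * ⟨ x , y ⟩) + (a * ⟨ z , y ⟩ + a * (b * ⟨ y , y ⟩))
        -- After this swap all terms except (x,z) are multiples of `b`, and their common cofactor is
        -- the sum that `μ-norm` shows to vanish.
        ≈⟨ +-congˡ (+-congʳ (μ-comm x z)) ⟩
      (⟨ x , z ⟩ + b * ⟨ x , y ⟩) + (b * ⟨ x , y ⟩ + a * (b * ⟨ y , y ⟩))
        ≈⟨ solve 5 (λ r b p a q → (r :+ b :* p) :+ (b :* p :+ a :* (b :* q))
                               := r :+ b :* (p :+ p :+ a :* q)) refl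
             ⟨ x , z ⟩ b ⟨ x , y ⟩ a ⟨ y , y ⟩ ⟩
      ⟨ x , z ⟩ + b * (⟨ x , y ⟩ + ⟨ x , y ⟩ + a * ⟨ y , y ⟩)
        ≈⟨ +-congˡ (trans (*-congˡ (μ-norm x)) (zeroʳ b)) ⟩
      ⟨ x , z ⟩ + 0#
        ≈⟨ +-identityʳ _ ⟩
      ⟨ x , z ⟩ ∎
      where
      open ≈-Reasoning setoid
      open SemiringSolver commutativeSemiring using (solve; _:=_; _:+_; _:*_)
      a = μ x
      b = μ z

    cartan-self : cartan y y ≈ 1# + 1#
    cartan-self = trans (*-assoc _ _ _) (trans (*-congˡ (⁻¹-inverseʳ _ yy≉0)) (*-identityʳ _))

    s-self : s y ≈ᴹ -ᴹ y
    s-self = inverseˡ-uniqueᴹ _ _ (begin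
      (y +ᴹ -ᴹ (cartan y y *ₗ y)) +ᴹ y   ≈⟨ +ᴹ-congʳ (+ᴹ-comm _ _) ⟩
      (-ᴹ (cartan y y *ₗ y) +ᴹ y) +ᴹ y   ≈⟨ +ᴹ-assoc _ _ _ ⟩
      -ᴹ (cartan y y *ₗ y) +ᴹ (y +ᴹ y)   ≈⟨ +ᴹ-congˡ (≈ᴹ-trans (*ₗ-congʳ cartan-self)
                                              (≈ᴹ-trans (*ₗ-distribʳ _ _ _)
                                                (+ᴹ-cong (*ₗ-identityˡ y) (*ₗ-identityˡ y)))) ⟨
      -ᴹ (cartan y y *ₗ y) +ᴹ cartan y y *ₗ y ≈⟨ -ᴹ‿inverseˡ _ ⟩
      0ᴹ                                 ∎)
      where open ≈-Reasoning vectors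

    s-involutive : ∀ x → s (s x) ≈ᴹ x
    s-involutive x = begin
      s (s x)                              ≈⟨ cong (s-def x) ⟩
      s (x +ᴹ μ x *ₗ y)                    ≈⟨ +-homo _ _ ⟩
      s x +ᴹ s (μ x *ₗ y)                  ≈⟨ +ᴹ-cong (s-def x) (*-homo _ _) ⟩
      (x +ᴹ μ x *ₗ y) +ᴹ μ x *ₗ s y        ≈⟨ +ᴹ-assoc _ _ _ ⟩
      x +ᴹ (μ x *ₗ y +ᴹ μ x *ₗ s y)        ≈⟨ +ᴹ-congˡ (*ₗ-distribˡ _ _ _) ⟨
      x +ᴹ μ x *ₗ (y +ᴹ s y)               ≈⟨ +ᴹ-congˡ (*ₗ-congˡ (≈ᴹ-trans (+ᴹ-congˡ s-self)
                                                (-ᴹ‿inverseʳ y))) ⟩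
      x +ᴹ μ x *ₗ 0ᴹ                       ≈⟨ +ᴹ-congˡ (*ₗ-zeroʳ _) ⟩
      x +ᴹ 0ᴹ                              ≈⟨ +ᴹ-identityʳ x ⟩
      x                                    ∎
      where
      open ≈-Reasoning vectors
      open Linear s-linear

    s-fixes : ∀ {x} → ⟨ x , y ⟩ ≈ 0# → s x ≈ᴹ x
    s-fixes {x} xy≈0 = ≈ᴹ-trans (s-def x) (≈ᴹ-trans (+ᴹ-congˡ (≈ᴹ-trans
      (*ₗ-congʳ (trans (-‿cong (trans (*-congʳ (trans (*-congˡ xy≈0) (zeroʳ _))) (zeroˡ _))) -0#≈0#))
      (*ₗ-zeroˡ y))) (+ᴹ-identityʳ x))

-- Words in the simple reflections

module Words {c ℓ₁ ℓ₂ v ℓv} {K : OrderedField c ℓ₁ ℓ₂}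
             {E : EuclideanSpace K v ℓv} {Φ : RootSystem E}
             (Π : SimpleSystem Φ) where
  open OrderedField K hiding (zero)
  open OrderedFieldProperties K
  open EuclideanSpace E
  open EuclideanProperties E
  open RootSystem Φ
  open SimpleSystem Π

  module s (β : Fin rank) = Reflection (simple β) (nonzero (index β))
  open s using (μ)

  -- The head letter acts last, so a word reads as a product of reflections from left to right.
  word : List (Fin rank) → Func vectors vectors
  word []      = Identity.function vectors
  word (β ∷ l) = Composition.function (word l) (reflection (simple β))

  act : List (Fin rank) → Carrierᴹ → Carrierᴹ
  act l = Func.to (word l)

  act-++ : ∀ l m x → act (l ++ m) x ≡ act l (act m x)
  act-++ []      m x = ≡.refl
  act-++ (β ∷ l) m x = ≡.cong (s.s β) (act-++ l m x)

  act-linear : ∀ l → Linear (act l)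
  act-linear [] = record
    { cong = id ; +-homo = λ _ _ → ≈ᴹ-refl ; *-homo = λ _ _ → ≈ᴹ-refl }
  act-linear (β ∷ l) = record
    { cong   = r.cong ∘ l.cong
    ; +-homo = λ x y → ≈ᴹ-trans (r.cong (l.+-homo x y)) (r.+-homo _ _)
    ; *-homo = λ k x → ≈ᴹ-trans (r.cong (l.*-homo k x)) (r.*-homo _ _)
    }
    where
    module r = Linear (s.s-linear β)
    module l = Linear (act-linear l)

  act-cong : ∀ l {x y} → x ≈ᴹ y → act l x ≈ᴹ act l y
  act-cong l = Linear.cong (act-linear l)

  act-isometry : ∀ l x y → ⟨ act l x , act l y ⟩ ≈ ⟨ x , y ⟩
  act-isometry []      x y = refl
  act-isometry (β ∷ l) x y = trans (s.s-isometry β _ _) (act-isometry l x y)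

  act-injective : ∀ l {x y} → act l x ≈ᴹ act l y → x ≈ᴹ y
  act-injective []      eq = eq
  act-injective (β ∷ l) eq = act-injective l (≈ᴹ-trans (≈ᴹ-sym (s.s-involutive β _))
    (≈ᴹ-trans (Func.cong (reflection (simple β)) eq) (s.s-involutive β _)))

  -- Each letter is an involution, so the reversed word is an inverse. It has the same letters and
  -- therefore stays in the same parabolic subgroup.
  act-right-inverse : ∀ {p} {P : Pred (Fin rank) p} l → All P l →
                      ∃ λ m → All P m × (∀ x → act l (act m x) ≈ᴹ x)
  act-right-inverse []      []        = [] , [] , λ _ → ≈ᴹ-refl
  act-right-inverse (β ∷ l) (pβ ∷ pl) =
    let m , pm , lm≈id = act-right-inverse l pl in
    m ∷ʳ β , ∷ʳ⁺ pm pβ , λ x → ≈ᴹ-trans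
      (Func.cong (reflection (simple β)) (≈ᴹ-trans
        (act-cong l (≈ᴹ-reflexive (act-++ m (β ∷ []) x))) (lm≈id _)))
      (s.s-involutive β x)

  act-generated : ∀ {p} {X : Pred (Fin rank) p} l → All (_∉ X) l → word l ∈ Generated Π X
  act-generated []      []        = identity
  act-generated (β ∷ l) (β∉ ∷ l∉) = compose (generator β∉) (act-generated l l∉)

  generated-act : ∀ {p} {X : Pred (Fin rank) p} {f} → f ∈ Generated Π X →
                  ∃ λ l → All (_∉ X) l × (∀ x → Func.to f x ≈ᴹ act l x)
  generated-act (generator {β} β∉) = β ∷ [] , β∉ ∷ [] , λ _ → ≈ᴹ-refl
  generated-act identity           = [] , [] , λ _ → ≈ᴹ-refl
  generated-act (compose f∈ g∈) =
    let l , l∉ , f≈l = generated-act f∈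
        m , m∉ , g≈m = generated-act g∈
    in l ++ m , ++⁺ l∉ m∉ , λ x → ≈ᴹ-trans (f≈l _)
         (≈ᴹ-trans (act-cong l (g≈m x)) (≈ᴹ-reflexive (≡.sym (act-++ l m x))))
  generated-act (inverse {f} {g} f∈ fg≈id gf≈id) =
    let l , l∉ , f≈l  = generated-act f∈
        m , m∉ , lm≈id = act-right-inverse l l∉
    -- `x` is rewritten as `f` applied to `act m x`, and `g` then cancels `f`.
    in m , m∉ , λ x → ≈ᴹ-trans
         (Func.cong g (≈ᴹ-sym (≈ᴹ-trans (f≈l _) (lm≈id x)))) (gf≈id _)

  generated-mono : ∀ {p q} {X : Pred (Fin rank) p} {Y : Pred (Fin rank) q} → X ⊆ Y →
                   Generated Π Y ⊆ Generated Π X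
  generated-mono X⊆Y (generator β∉)     = generator (β∉ ∘ X⊆Y)
  generated-mono X⊆Y identity           = identity
  generated-mono X⊆Y (compose f∈ g∈)    = compose (generated-mono X⊆Y f∈) (generated-mono X⊆Y g∈)
  generated-mono X⊆Y (inverse f∈ fg gf) = inverse (generated-mono X⊆Y f∈) fg gf

  -- Action on root indices and finiteness of parabolic subgroups

  σ : Fin rank → Fin size → Fin size
  σ β i = proj₁ (closed (index β) i)

  perm : List (Fin rank) → Fin size → Fin size
  perm []      i = i
  perm (β ∷ l) i = σ β (perm l i)

  perm-++ : ∀ l m i → perm (l ++ m) i ≡ perm l (perm m i)
  perm-++ []      m i = ≡.refl
  perm-++ (β ∷ l) m i = ≡.cong (σ β) (perm-++ l m i)

  act-root : ∀ l i → act l (root i) ≈ᴹ root (perm l i)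
  act-root []      i = ≈ᴹ-refl
  act-root (β ∷ l) i = ≈ᴹ-trans (Func.cong (reflection (simple β)) (act-root l i))
    (proj₂ (closed (index β) (perm l i)))

  -- The roots span, so a linear map is determined by its values on them. Equality of group elements
  -- thus reduces to equality of maps on a finite set, which is decidable.
  perm⇒act : ∀ l m → perm l ≗ perm m → ∀ x → act l x ≈ᴹ act m x
  perm⇒act l m eq x = begin
    act l x                  ≈⟨ act-cong l x≈ ⟩
    act l (lincomb k root)   ≈⟨ Linear.lincomb-homo (act-linear l) k root ⟩
    lincomb k (act l ∘ root) ≈⟨ lincomb-cong {k = k} (λ _ → refl) (λ i → ≈ᴹ-trans (act-root l i)
                                  (≈ᴹ-trans (≈ᴹ-reflexive (≡.cong root (eq i)))
                                    (≈ᴹ-sym (act-root m i)))) ⟩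
    lincomb k (act m ∘ root) ≈⟨ Linear.lincomb-homo (act-linear m) k root ⟨
    act m (lincomb k root)   ≈⟨ act-cong m x≈ ⟨
    act m x                  ∎
    where
    open ≈-Reasoning vectors
    k = proj₁ (spans x)
    x≈ = proj₂ (spans x)

  act⇒perm : ∀ l m → (∀ x → act l x ≈ᴹ act m x) → perm l ≗ perm m
  act⇒perm l m eq i = root-injective
    (≈ᴹ-trans (≈ᴹ-sym (act-root l i)) (≈ᴹ-trans (eq _) (act-root m i)))

  shorten : ∀ {p} {P : Pred (Fin rank) p} l → All P l → Acc ℕ._<_ (length l) →
            ∃ λ m → All P m × length m ℕ.≤ size ℕ.^ size × perm l ≗ perm m
  shorten l pl (acc rec) with length l ℕ.≤? size ℕ.^ size
  ... | yes short = l , pl , short , λ _ → ≡.refl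
  ... | no  long
    -- A word has one more suffix than it has letters, since the empty suffix counts too. `funToFin`
    -- codes the self-map of each suffix as one of `size ^ size` values, so two suffixes share a
    -- code.
    with i , j , i<j , eq ← Fin.pigeonhole (ℕ.m≤n⇒m≤1+n (ℕ.≰⇒> long))
                              (λ (i : Fin (ℕ.suc (length l))) → funToFin (perm (drop (toℕ i) l))) =
    let m′ , pm′ , short , eq′ = shorten m (++⁺ (take⁺ (toℕ i) pl) (drop⁺ (toℕ j) pl)) (rec m<l)
    in m′ , pm′ , short , λ k → ≡.trans (l≗m k) (eq′ k)
    where
    m = take (toℕ i) l ++ drop (toℕ j) l

    m<l : length m ℕ.< length l
    m<l = begin-strict
      length m
        ≡⟨ length-++ (take (toℕ i) l) ⟩
      length (take (toℕ i) l) ℕ.+ length (drop (toℕ j) l)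
        ≡⟨ ≡.cong₂ ℕ._+_ (length-take (toℕ i) l) (length-drop (toℕ j) l) ⟩
      toℕ i ℕ.⊓ length l ℕ.+ (length l ℕ.∸ toℕ j)
        ≤⟨ ℕ.+-monoˡ-≤ _ (ℕ.m⊓n≤m (toℕ i) (length l)) ⟩
      toℕ i ℕ.+ (length l ℕ.∸ toℕ j)
        <⟨ ℕ.+-monoˡ-< _ i<j ⟩
      toℕ j ℕ.+ (length l ℕ.∸ toℕ j)
        ≡⟨ ℕ.m+[n∸m]≡n (Fin.toℕ≤pred[n] j) ⟩
      length l ∎
      where open ℕ.≤-Reasoning

    drop≗ : perm (drop (toℕ i) l) ≗ perm (drop (toℕ j) l)
    drop≗ k = ≡.trans (≡.sym (Fin.finToFun-funToFin (perm (drop (toℕ i) l)) k))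
      (≡.trans (≡.cong (λ f → finToFun {size} {size} f k) eq)
        (Fin.finToFun-funToFin (perm (drop (toℕ j) l)) k))

    l≗m : perm l ≗ perm m
    l≗m k = begin
      perm l k
        ≡⟨ ≡.cong (λ l → perm l k) (take++drop≡id (toℕ i) l) ⟨
      perm (take (toℕ i) l ++ drop (toℕ i) l) k
        ≡⟨ perm-++ (take (toℕ i) l) _ k ⟩
      perm (take (toℕ i) l) (perm (drop (toℕ i) l) k)
        ≡⟨ ≡.cong (perm (take (toℕ i) l)) (drop≗ k) ⟩
      perm (take (toℕ i) l) (perm (drop (toℕ j) l) k)
        ≡⟨ perm-++ (take (toℕ i) l) _ k ⟨
      perm m k ∎
      where open ≡.≡-Reasoning

  -- By `shorten`, words of length at most `size ^ size` represent all elements. Words with a letter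
  -- in `X` decode to nothing, and elements are compared through the maps they induce on root
  -- indices.
  W-finite : ∀ {p} {X : Pred (Fin rank) p} → Decidable X → ∃ (HasCardinality (W[_] Π X))
  W-finite {X = X} X? = finite (W[_] Π X) dec (words (size ℕ.^ size) (allFin rank)) element complete
    where
    allowed? : Decidable (All (_∉ X))
    allowed? = All.all? (¬? ∘ X?)

    element : List (Fin rank) → Maybe (∃ (Generated Π X))
    element l = Maybe.map (λ l∉ → word l , act-generated l l∉) (dec⇒maybe (allowed? l))

    dec : ∀ f g → Dec (Setoid._≈_ (W[_] Π X) f g)
    dec (f , f∈) (g , g∈) =
      let l , _ , f≈l = generated-act f∈
          m , _ , g≈m = generated-act g∈
      in map′ (λ eq x → ≈ᴹ-trans (f≈l x) (≈ᴹ-trans (perm⇒act l m eq x) (≈ᴹ-sym (g≈m x))))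
              (λ f≈g → act⇒perm l m (λ x → ≈ᴹ-trans (≈ᴹ-sym (f≈l x)) (≈ᴹ-trans (f≈g x) (g≈m x))))
              (Fin.all? (λ i → perm l i Fin.≟ perm m i))

    complete : ∀ f → Any _ (words (size ℕ.^ size) (allFin rank))
    complete (f , f∈) =
      let l , l∉ , f≈l = generated-act f∈
          m , m∉ , short , l≗m = shorten l l∉ (ℕ.<-wellFounded _)
      in Any.map (λ { ≡.refl → dec⇒maybe-any _ (allowed? m) m∉
                       λ _ x → ≈ᴹ-trans (f≈l x) (perm⇒act l m l≗m x) })
                 (∈-words ∈-allFin m short)

-- Simple coordinates and their change under reflections

module SimpleRoots {c ℓ₁ ℓ₂ v ℓv} {K : OrderedField c ℓ₁ ℓ₂}
             {E : EuclideanSpace K v ℓv} {Φ : RootSystem E}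
             (Π : SimpleSystem Φ) where
  open OrderedField K hiding (zero)
  open OrderedFieldProperties K
  open EuclideanSpace E
  open EuclideanProperties E
  open RootSystem Φ
  open SimpleSystem Π
  open Words Π
  open s using (μ)

  coord-unique : ∀ {k l} → lincomb k simple ≈ᴹ lincomb l simple → ∀ ε → k ε ≈ l ε
  coord-unique {k} {l} eq ε = x∙y⁻¹≈ε⇒x≈y _ _ (trans (+-congˡ (sym (-1*x≈-x _)))
    (independent (λ ε → k ε + - 1# * l ε) (begin
      lincomb (λ ε → k ε + - 1# * l ε) simple    ≈⟨ lincomb-+ k _ simple ⟩
      lincomb k simple +ᴹ lincomb (λ ε → - 1# * l ε) simple
                                                 ≈⟨ +ᴹ-cong eq (lincomb-* (- 1#) l simple) ⟩
      lincomb l simple +ᴹ - 1# *ₗ lincomb l simple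
                                                 ≈⟨ +ᴹ-congˡ (-ᴹ‿distribˡ-*ₗ 1# _) ⟨
      lincomb l simple +ᴹ -ᴹ (1# *ₗ lincomb l simple)
                                                 ≈⟨ +ᴹ-congˡ (-ᴹ‿cong (*ₗ-identityˡ _)) ⟩
      lincomb l simple +ᴹ -ᴹ lincomb l simple    ≈⟨ -ᴹ‿inverseʳ _ ⟩
      0ᴹ                                         ∎) ε))
    where
    open ≈-Reasoning vectors
    open RingProperties ring using (-1*x≈-x; x∙y⁻¹≈ε⇒x≈y)

  -- The unit vector is written as an update of the zero vector so that the lemmas about `updateAt`
  -- apply to it.
  coord-index : ∀ β ε → coord (index β) ε ≈ updateAt (const 0#) β (_+ 1#) ε
  coord-index β = coord-unique (≈ᴹ-trans (≈ᴹ-sym (expansion (index β))) (≈ᴹ-sym (≈ᴹ-trans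
    (lincomb-updateAt (const 0#) simple β 1#) (≈ᴹ-trans
      (+ᴹ-cong (lincomb-zero simple) (*ₗ-identityˡ _)) (+ᴹ-identityˡ _)))))

  coord-index-≡ : ∀ β → coord (index β) β ≈ 1#
  coord-index-≡ β = trans (coord-index β β)
    (trans (reflexive (updateAt-updates β (const 0#))) (+-identityˡ 1#))

  coord-index-≢ : ∀ {β ε} → ε ≢ β → coord (index β) ε ≈ 0#
  coord-index-≢ {β} {ε} ε≢β =
    trans (coord-index β ε) (reflexive (updateAt-minimal ε β (const 0#) ε≢β))

  -- A root and its reflection differ by a multiple of the simple root β, so only the coordinate at
  -- β moves. This is why words without α preserve the α-coordinate.
  coord-σ : ∀ β i ε → coord (σ β i) ε ≈ updateAt (coord i) β (_+ μ β (root i)) ε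
  coord-σ β i = coord-unique (begin
    lincomb (coord (σ β i)) simple                    ≈⟨ expansion _ ⟨
    root (σ β i)                                      ≈⟨ proj₂ (closed (index β) i) ⟨
    s.s β (root i)                                    ≈⟨ s.s-def β (root i) ⟩
    root i +ᴹ μ β (root i) *ₗ simple β                ≈⟨ +ᴹ-congʳ (expansion i) ⟩
    lincomb (coord i) simple +ᴹ μ β (root i) *ₗ simple β ≈⟨ lincomb-updateAt (coord i) simple β _ ⟨
    lincomb (updateAt (coord i) β (_+ μ β (root i))) simple ∎)
    where open ≈-Reasoning vectors

  coord-σ-≡ : ∀ β i → coord (σ β i) β ≈ coord i β + μ β (root i)
  coord-σ-≡ β i = trans (coord-σ β i β) (reflexive (updateAt-updates β (coord i)))

  coord-σ-≢ : ∀ {β ε} i → ε ≢ β → coord (σ β i) ε ≈ coord i ε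
  coord-σ-≢ {β} {ε} i ε≢β =
    trans (coord-σ β i ε) (reflexive (updateAt-minimal ε β (coord i) ε≢β))

  coord-perm : ∀ {ε} l i → All (ε ≢_) l → coord (perm l i) ε ≈ coord i ε
  coord-perm []      i []          = refl
  coord-perm (β ∷ l) i (ε≢β ∷ ε∉l) = trans (coord-σ-≢ (perm l i) ε≢β) (coord-perm l i ε∉l)

  -- Signs of roots and the exchange condition

  Positive Negative : Pred (Fin size) _
  Positive i = ∀ ε → 0# ≤ coord i ε
  Negative i = ∀ ε → coord i ε ≤ 0#

  -- Were the product positive, the reflection of β in α would have coordinate 1 at β and a negative
  -- coordinate at α, contrary to `same-sign`.
  simple-obtuse : ∀ {α β} → β ≢ α → ⟨ simple β , simple α ⟩ ≤ 0#
  simple-obtuse {α} {β} β≢α = ≯⇒≤ λ 0<βα → case-sign 0<βα (same-sign (σ α (index β)))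
    where
    case-sign : 0# < ⟨ simple β , simple α ⟩ →
                ¬ (Positive (σ α (index β)) ⊎ Negative (σ α (index β)))
    case-sign 0<βα (inj₁ pos) = ≤⇒≯
      (≤-respʳ-≈ (trans (coord-σ-≡ α (index β))
                   (trans (+-congʳ (coord-index-≢ (β≢α ∘ ≡.sym))) (+-identityˡ _)))
                 (pos α))
      (s.μ-pos⇒neg α 0<βα)
    case-sign _    (inj₂ neg) =
      1≰0 (≤-respˡ-≈ (trans (coord-σ-≢ (index β) β≢α) (coord-index-≡ β)) (neg β))

  -- Coordinates away from γ survive the reflection, so they are both nonnegative and nonpositive
  -- and vanish. The root is then a multiple of γ; reducedness leaves the factors 1 and -1, and
  -- positivity excludes the latter.
  sign-change⇒simple : ∀ {γ i} → Positive i → Negative (σ γ i) → root i ≈ᴹ simple γ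
  sign-change⇒simple {γ} {i} pos neg = conclude (reduced i (index γ) (coord i γ) root≈)
    where
    coord≈ : ∀ ε → coord i ε ≈ updateAt (const 0#) γ (_+ coord i γ) ε
    coord≈ ε with ε Fin.≟ γ
    ... | yes ≡.refl = trans
      (sym (+-identityˡ _)) (reflexive (≡.sym (updateAt-updates ε (const 0#))))
    ... | no  ε≢γ    = trans
      (≤-antisym (≤-respˡ-≈ (coord-σ-≢ i ε≢γ) (neg ε)) (pos ε))
      (reflexive (≡.sym (updateAt-minimal ε γ (const 0#) ε≢γ)))
    root≈ : root i ≈ᴹ coord i γ *ₗ simple γ
    root≈ = ≈ᴹ-trans (expansion i) (≈ᴹ-trans (lincomb-cong {x = simple} coord≈ (λ _ → ≈ᴹ-refl))
      (≈ᴹ-trans (lincomb-updateAt (const 0#) simple γ _)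
        (≈ᴹ-trans (+ᴹ-congʳ (lincomb-zero simple)) (+ᴹ-identityˡ _))))

    conclude : coord i γ ≈ 1# ⊎ coord i γ ≈ - 1# → root i ≈ᴹ simple γ
    conclude (inj₁ γ≈1)  = ≈ᴹ-trans root≈ (≈ᴹ-trans (*ₗ-congʳ γ≈1) (*ₗ-identityˡ _))
    conclude (inj₂ γ≈-1) = contradiction (pos⇒-neg 0<1) (≤⇒≯ (≤-respʳ-≈ γ≈-1 (pos γ)))

  -- The simple root β starts positive and ends negative, so some letter γ of `l` flips the sign of
  -- its image. The suffix after that letter sends β to γ, hence multiplying by the reflection in β
  -- on the right amounts to deleting γ.
  exchange : ∀ {p} {P : Pred (Fin rank) p} l β → All P l → Negative (perm l (index β)) →
             ∃ λ m → All P m × length m ℕ.< length l × (∀ x → act l (s.s β x) ≈ᴹ act m x)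
  exchange []      β []        neg = contradiction (≤-respˡ-≈ (coord-index-≡ β) (neg β)) 1≰0
  exchange (γ ∷ l) β (pγ ∷ pl) neg with same-sign (perm l (index β))
  ... | inj₂ neg′ =
    let m , pm , m<l , eq = exchange l β pl neg′
    in γ ∷ m , pγ ∷ pm , ℕ.s≤s m<l , λ x → Func.cong (reflection (simple γ)) (eq x)
  ... | inj₁ pos  = l , pl , ℕ.n<1+n _ , λ x → begin
    s.s γ (act l (s.s β x))    ≈⟨ Func.cong (reflection (simple γ)) (conjugate x) ⟩
    s.s γ (s.s γ (act l x))    ≈⟨ s.s-involutive γ _ ⟩
    act l x                    ∎
    where
    open ≈-Reasoning vectors
    module l = Linear (act-linear l)

    lβ≈γ : act l (simple β) ≈ᴹ simple γ
    lβ≈γ = ≈ᴹ-trans (act-root l (index β)) (sign-change⇒simple pos neg)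

    μ≈ : ∀ x → μ β x ≈ μ γ (act l x)
    μ≈ x = -‿cong (*-cong (*-congˡ (sym (product x))) (⁻¹-cong (s.yy≉0 β) (sym norm)))
      where
      product : ∀ x → ⟨ act l x , simple γ ⟩ ≈ ⟨ x , simple β ⟩
      product x = trans (⟨,⟩-congˡ (≈ᴹ-sym lβ≈γ)) (act-isometry l x (simple β))
      norm : ⟨ simple γ , simple γ ⟩ ≈ ⟨ simple β , simple β ⟩
      norm = trans (⟨,⟩-congʳ (≈ᴹ-sym lβ≈γ)) (product (simple β))

    -- s_γ = l s_β l⁻¹ because l maps β to γ.
    conjugate : ∀ x → act l (s.s β x) ≈ᴹ s.s γ (act l x)
    conjugate x = begin
      act l (s.s β x)                      ≈⟨ l.cong (s.s-def β x) ⟩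
      act l (x +ᴹ μ β x *ₗ simple β)       ≈⟨ l.+-homo _ _ ⟩
      act l x +ᴹ act l (μ β x *ₗ simple β) ≈⟨ +ᴹ-congˡ (l.*-homo _ _) ⟩
      act l x +ᴹ μ β x *ₗ act l (simple β) ≈⟨ +ᴹ-congˡ (*ₗ-cong (μ≈ x) lβ≈γ) ⟩
      act l x +ᴹ μ γ (act l x) *ₗ simple γ ≈⟨ s.s-def γ _ ⟨
      s.s γ (act l x)                      ∎

  -- Height of roots

  height : Fin size → Carrier
  height i = sum (coord i)

  height-σ : ∀ β i → height (σ β i) ≈ height i + μ β (root i)
  height-σ β i = trans (sum-cong-≋ (coord-σ β i)) (sum-updateAt (coord i) β _)

  -- Heights are field elements, so the descent does not come from the natural numbers: any strict
  -- partial order on a finite index set is well-founded.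
  height-wellFounded : WellFounded (λ i j → height i < height j)
  height-wellFounded = spo-wellFounded record
    { isEquivalence = ≡.isEquivalence
    ; irrefl        = λ { ≡.refl → irrefl refl }
    ; trans         = <-trans
    ; <-resp-≈      = ≡.resp₂ _
    }

  -- The stabiliser of α

  module _ (α : Fin rank) where

    Orthogonal : Pred (Fin rank) _
    Orthogonal ε = ⟨ simple ε , simple α ⟩ ≈ 0#

    orthogonal-fixes : ∀ l → All Orthogonal l → act l (simple α) ≈ᴹ simple α
    orthogonal-fixes []      []        = ≈ᴹ-refl
    orthogonal-fixes (β ∷ l) (βα ∷ lα) = ≈ᴹ-trans
      (Func.cong (reflection (simple β)) (orthogonal-fixes l lα))
      (s.s-fixes β (trans (⟨,⟩-sym _ _) βα))

    -- In the expansion of the root the α-term vanishes, and each other term is a nonnegative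
    -- coordinate times a nonpositive product of distinct simple roots.
    positive-obtuse : ∀ {i} → Positive i → coord i α ≈ 0# → ⟨ root i , simple α ⟩ ≤ 0#
    positive-obtuse {i} pos αi≈0 = ≤-respˡ-≈
      (sym (trans (⟨,⟩-congʳ (expansion i)) (⟨,⟩-lincomb (coord i) simple _)))
      (sum-nonpos _ term)
      where
      term : ∀ ε → coord i ε * ⟨ simple ε , simple α ⟩ ≤ 0#
      term ε with ε Fin.≟ α
      ... | yes ≡.refl = inj₂ (trans (*-congʳ αi≈0) (zeroˡ _))
      ... | no  ε≢α    = *-nonneg-nonpos (pos ε) (simple-obtuse ε≢α)

    -- The last letter is split off because it acts first: the sign of its image under the remaining
    -- word decides between shortening the whole word and peeling that letter off.
    stabiliser : ∀ l → Acc ℕ._<_ (length l) → All (α ≢_) l → act l (simple α) ≈ᴹ simple α →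
                 ∃ λ m → All Orthogonal m × (∀ x → act l x ≈ᴹ act m x)
    stabiliser l (acc rec) α∉l fix with initLast l
    ... | [] = [] , [] , λ _ → ≈ᴹ-refl
    ... | k ∷ʳ′ β with same-sign (perm k (index β)) | ∷ʳ⁻ α∉l
    ...   | inj₂ neg | α∉k , α≢β =
      let m , α∉m , m<k , eq = exchange k β α∉k neg
          kβ≈m x = ≈ᴹ-trans (≈ᴹ-reflexive (act-++ k (β ∷ []) x)) (eq x)
          n , nα , m≈n = stabiliser m (rec (ℕ.<-trans m<k (length-∷ʳ k β))) α∉m
            (≈ᴹ-trans (≈ᴹ-sym (kβ≈m _)) fix)
      in n , nα , λ x → ≈ᴹ-trans (kβ≈m x) (m≈n x)
    ...   | inj₁ pos | α∉k , α≢β =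
      let m , mα , k≈m = stabiliser k (rec (length-∷ʳ k β)) α∉k
            (≈ᴹ-trans (act-cong k (≈ᴹ-sym (s.s-fixes β (trans (⟨,⟩-sym _ _) βα≈0)))) fix′)
      in m ∷ʳ β , ∷ʳ⁺ mα βα≈0 , λ x → ≈ᴹ-trans (≈ᴹ-reflexive (act-++ k (β ∷ []) x))
           (≈ᴹ-trans (k≈m _) (≈ᴹ-reflexive (≡.sym (act-++ m (β ∷ []) x))))
      where
      fix′ : act k (s.s β (simple α)) ≈ᴹ simple α
      fix′ = ≈ᴹ-trans (≈ᴹ-reflexive (≡.sym (act-++ k (β ∷ []) (simple α)))) fix

      -- The isometry `k` sends the reflection of α in β to α, so it can be cancelled from the
      -- product.
      kβ-α : ⟨ root (perm k (index β)) , simple α ⟩ ≈ ⟨ simple β , s.s β (simple α) ⟩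
      kβ-α = trans (⟨,⟩-cong (≈ᴹ-sym (act-root k (index β))) (≈ᴹ-sym fix′))
        (act-isometry k (simple β) (s.s β (simple α)))

      -- As `k` has no letter α, the positive root to which it sends β still has α-coordinate zero.
      kβ-α≤0 : ⟨ simple β , s.s β (simple α) ⟩ ≤ 0#
      kβ-α≤0 = ≤-respˡ-≈ kβ-α (positive-obtuse pos
        (trans (coord-perm k (index β) α∉k) (coord-index-≢ α≢β)))

      opposite : ⟨ simple β , simple α ⟩ + ⟨ simple β , s.s β (simple α) ⟩ ≈ 0#
      opposite = begin
        ⟨ simple β , simple α ⟩ + ⟨ simple β , s.s β (simple α) ⟩
          ≈⟨ +-cong (⟨,⟩-sym _ _) (trans (⟨,⟩-sym _ _) (trans (⟨,⟩-congʳ (s.s-def β _))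
               (trans (⟨,⟩-+ _ _ _) (+-congˡ (⟨,⟩-* _ _ _))))) ⟩
        ⟨ simple α , simple β ⟩ + (⟨ simple α , simple β ⟩ + μ β (simple α) * ⟨ simple β , simple β ⟩)
          ≈⟨ +-assoc _ _ _ ⟨
        ⟨ simple α , simple β ⟩ + ⟨ simple α , simple β ⟩ + μ β (simple α) * ⟨ simple β , simple β ⟩
          ≈⟨ s.μ-norm β (simple α) ⟩
        0# ∎
        where open ≈-Reasoning setoid

      -- Two nonpositive numbers that sum to zero both vanish.
      βα≈0 : Orthogonal β
      βα≈0 = x≤0∧y≤0∧x+y≈0⇒x≈0 (simple-obtuse (α≢β ∘ ≡.sym)) kβ-α≤0 opposite

    -- The orbit of α

    -- These roots form the orbit of α under W_α: `transitive` shows that each of them is reached,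
    -- and `perm-conjugate` that the orbit does not leave them.
    Conjugate : Pred (Fin size) _
    Conjugate = Φ[_,1] Π α ∩ SameLength Π α

    conjugate? : Decidable Conjugate
    conjugate? i = coord i α ≟ 1# ×-dec ⟨ root i , root i ⟩ ≟ ⟨ simple α , simple α ⟩

    descended⇒simple : ∀ {i} → i ∈ Conjugate → (∀ β → α ≢ β → ⟨ root i , simple β ⟩ ≤ 0#) →
                       root i ≈ᴹ simple α
    descended⇒simple {i} (αi≈1 , same) obtuse = begin
      γ                  ≈⟨ inverseˡ-uniqueᴹ γ _ (⟨,⟩-definite x xx≈0) ⟩
      -ᴹ (- 1# *ₗ a)     ≈⟨ -ᴹ‿distribˡ-*ₗ (- 1#) a ⟩
      - (- 1#) *ₗ a      ≈⟨ *ₗ-congʳ (-‿involutive 1#) ⟩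
      1# *ₗ a            ≈⟨ *ₗ-identityˡ a ⟩
      a                  ∎
      where
      open ≈-Reasoning vectors
      γ = root i
      a = simple α
      x = γ +ᴹ - 1# *ₗ a
      -- The simple coordinates of `x`: those of γ, with the coordinate 1 at α cancelled.
      d = updateAt (coord i) α (_+ - 1#)

      nonneg : Positive i
      nonneg with same-sign i
      ... | inj₁ pos = pos
      ... | inj₂ neg = contradiction (≤-respˡ-≈ αi≈1 (neg α)) 1≰0

      term : ∀ ε → d ε * ⟨ simple ε , γ ⟩ ≤ 0#
      term ε with ε Fin.≟ α
      ... | yes ≡.refl = inj₂ (trans (*-congʳ (trans (reflexive (updateAt-updates ε (coord i)))
                           (trans (+-congʳ αi≈1) (-‿inverseʳ 1#)))) (zeroˡ _))
      ... | no  ε≢α    = *-nonneg-nonpos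
        (≤-respʳ-≈ (reflexive (≡.sym (updateAt-minimal ε α (coord i) ε≢α))) (nonneg ε))
        (≤-respˡ-≈ (⟨,⟩-sym _ _) (obtuse ε (ε≢α ∘ ≡.sym)))

      xγ≤0 : ⟨ x , γ ⟩ ≤ 0#
      xγ≤0 = ≤-respˡ-≈ (sym (trans
        (⟨,⟩-congʳ (≈ᴹ-trans (+ᴹ-congʳ (expansion i))
          (≈ᴹ-sym (lincomb-updateAt (coord i) simple α (- 1#)))))
        (⟨,⟩-lincomb d simple γ)))
        (sum-nonpos _ term)

      ⟨x,_⟩ : ∀ y → ⟨ x , y ⟩ ≈ ⟨ γ , y ⟩ + - 1# * ⟨ a , y ⟩
      ⟨x, y ⟩ = trans (⟨,⟩-+ _ _ _) (+-congˡ (⟨,⟩-* _ _ _))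

      -- Equality of lengths enters here: (γ - α, γ + α) is the difference of the squared lengths.
      opposite : ⟨ x , a ⟩ + ⟨ x , γ ⟩ ≈ 0#
      opposite = trans (+-cong ⟨x, a ⟩ ⟨x, γ ⟩) (trans
        (+-congˡ (+-cong same (*-congˡ (⟨,⟩-sym a γ))))
        (trans (solve 3 (λ p m q → (p :+ m :* q) :+ (q :+ m :* p) := (con 1 :+ m) :* (p :+ q)) refl
                 ⟨ γ , a ⟩ (- 1#) ⟨ a , a ⟩)
               (trans (*-congʳ (-‿inverseʳ 1#)) (zeroˡ _))))
        where open SemiringSolver commutativeSemiring

      xx≤0 : ⟨ x , x ⟩ ≤ 0#
      -- By `opposite`, (x,x) = (x,γ) - (x,α) is twice (x,γ).
      xx≤0 = ≤-respˡ-≈ (sym (trans (⟨,⟩-+ʳ _ _ _) (+-congˡ (trans (⟨,⟩-*ʳ _ _ _)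
               (trans (-1*x≈-x _) (sym (+-inverseʳ-unique _ _ opposite)))))))
             (+-nonpos xγ≤0 xγ≤0)
        where open RingProperties ring using (-1*x≈-x; +-inverseʳ-unique)

      xx≈0 : ⟨ x , x ⟩ ≈ 0#
      xx≈0 = ≤-antisym xx≤0 (⟨,⟩-nonneg x)

    -- Descent on height: a lowering reflection other than that in α is found by finite search, it
    -- preserves both the α-coordinate and the length, and prepending it to the word for the lower
    -- root undoes the step.
    transitive : ∀ i → Acc (λ i j → height i < height j) i → i ∈ Conjugate →
                 ∃ λ l → All (α ≢_) l × act l (simple α) ≈ᴹ root i
    transitive i (acc rec) i∈@(αi≈1 , same)
      with Fin.any? (λ β → ¬? (α Fin.≟ β) ×-dec (0# <? ⟨ root i , simple β ⟩))
    ... | no  none            = [] , [] , ≈ᴹ-sym (descended⇒simple i∈ λ β α≢β →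
      ≯⇒≤ λ 0<iβ → none (β , α≢β , 0<iβ))
    ... | yes (β , α≢β , 0<iβ) =
      let l , α∉l , lα≈ = transitive (σ β i) (rec lower)
            (trans (coord-σ-≢ i α≢β) αi≈1 ,
             trans (trans (⟨,⟩-cong sβi sβi) (s.s-isometry β _ _)) same)
      in β ∷ l , α≢β ∷ α∉l , ≈ᴹ-trans
           (Func.cong (reflection (simple β)) (≈ᴹ-trans lα≈ sβi)) (s.s-involutive β _)
      where
      sβi : root (σ β i) ≈ᴹ s.s β (root i)
      sβi = ≈ᴹ-sym (proj₂ (closed (index β) i))

      lower : height (σ β i) < height i
      lower = <-respˡ-≈ (trans (+-comm _ _) (sym (height-σ β i)))
        (<-respʳ-≈ (+-identityˡ _) (+-monoˡ-< (height i) (s.μ-pos⇒neg β 0<iβ)))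

    -- Orbit-stabiliser count

    ｛α｝⊆Ñ : ｛ α ｝ ⊆ Ñ[_] Π α
    ｛α｝⊆Ñ ≡.refl = s.yy≉0 α

    Ñ? : Decidable (Ñ[_] Π α)
    Ñ? ε = ¬? (⟨ simple ε , simple α ⟩ ≟ 0#)

    W-Ñ-fixes : ∀ {f} → f ∈ Generated Π (Ñ[_] Π α) → Func.to f (simple α) ≈ᴹ simple α
    W-Ñ-fixes f∈ =
      let l , l∉ , f≈l = generated-act f∈
      -- Lying outside `Ñ[ α ]` is a doubly negated orthogonality, which decidable equality of
      -- scalars resolves.
      in ≈ᴹ-trans (f≈l _) (orthogonal-fixes l (All.map (decidable-stable (_ ≟ 0#)) l∉))

    perm-conjugate : ∀ l → All (α ≢_) l → perm l (index α) ∈ Conjugate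
    perm-conjugate l α∉l = trans (coord-perm l (index α) α∉l) (coord-index-≡ α)
      , trans (⟨,⟩-cong lα lα) (act-isometry l _ _)
      where lα = ≈ᴹ-sym (act-root l (index α))

    -- Choosing for each root of the orbit a word that carries α to it gives coset representatives:
    -- every element of W_α is uniquely a representative times an element fixing α. The finiteness
    -- of W_α comes out of this factorisation as well.
    orbit-stabiliser : ∀ {n b} → HasCardinality (rootSubset Φ Conjugate) n →
                       HasCardinality (W[_] Π (Ñ[_] Π α)) b →
                       HasCardinality (W[_] Π ｛ α ｝) (n ℕ.* b)
    orbit-stabiliser {n} {b} roots stab = ×-cardinality (W[_] Π ｛ α ｝) product
      (λ {i} {i′} {j} {j′} → product-injective i i′ j j′) product-surjective
      where
      module R = Bijection roots
      module H = Bijection stab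

      transversal : ∀ i → ∃ λ l → All (α ≢_) l × act l (simple α) ≈ᴹ root (proj₁ (R.to i))
      transversal i = transitive _ (height-wellFounded _) (proj₂ (R.to i))

      t : Fin n → List (Fin rank)
      t i = proj₁ (transversal i)

      h : Fin b → Func vectors vectors
      h j = proj₁ (H.to j)

      product : Fin n → Fin b → ∃ (Generated Π ｛ α ｝)
      product i j = Composition.function (h j) (word (t i)) ,
        compose (act-generated (t i) (proj₁ (proj₂ (transversal i))))
                (generated-mono ｛α｝⊆Ñ (proj₂ (H.to j)))

      _≋_ = Setoid._≈_ (W[_] Π ｛ α ｝)

      product-α : ∀ i j → Func.to (proj₁ (product i j)) (simple α) ≈ᴹ root (proj₁ (R.to i))
      product-α i j = ≈ᴹ-trans (act-cong (t i) (W-Ñ-fixes (proj₂ (H.to j))))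
        (proj₂ (proj₂ (transversal i)))

      product-injective : ∀ i i′ j j′ → product i j ≋ product i′ j′ → i ≡ i′ × j ≡ j′
      product-injective i i′ j j′ eq
        -- Evaluation at α recovers the root and so the index `i`; the common representative is then
        -- cancelled.
        with R.injective {i} {i′} (root-injective
               (≈ᴹ-trans (≈ᴹ-sym (product-α i j)) (≈ᴹ-trans (eq _) (product-α i′ j′))))
      ... | ≡.refl = ≡.refl , H.injective λ x → act-injective (t i) (eq x)

      product-surjective : ∀ w → ∃ λ i → ∃ λ j → product i j ≋ w
      product-surjective (f , f∈) =
        -- The index `i` is that of the root to which `f` sends α. With `m` inverse to `t i`, the
        -- word `m ++ l` represents the remaining factor, which has to be shown to lie in the
        -- smaller subgroup.
        let l , α∉l , f≈l = generated-act f∈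
            i , i↦lα = R.strictlySurjective (perm l (index α) , perm-conjugate l α∉l)
            m , α∉m , tm≈id = act-right-inverse (t i) (proj₁ (proj₂ (transversal i)))
            tml≈f x = begin
              act (t i) (act (m ++ l) x)  ≡⟨ ≡.cong (act (t i)) (act-++ m l x) ⟩
              act (t i) (act m (act l x)) ≈⟨ tm≈id _ ⟩
              act l x                     ≈⟨ f≈l x ⟨
              Func.to f x                 ∎
            -- Both `f` and `t i` send α to the same root, so injectivity of `t i` makes `m ++ l`
            -- fix α.
            ml-fixes = act-injective (t i) (begin
              act (t i) (act (m ++ l) (simple α)) ≈⟨ tml≈f _ ⟩
              Func.to f (simple α)                ≈⟨ f≈l _ ⟩
              act l (simple α)                    ≈⟨ act-root l (index α) ⟩
              root (perm l (index α))             ≡⟨ ≡.cong root i↦lα ⟨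
              root (proj₁ (R.to i))               ≈⟨ proj₂ (proj₂ (transversal i)) ⟨
              act (t i) (simple α)                ∎)
            k , kα , ml≈k = stabiliser (m ++ l) (ℕ.<-wellFounded _) (++⁺ α∉m α∉l) ml-fixes
            j , hj≈k = H.strictlySurjective
              (word k , act-generated k (All.map (λ εα≈0 ε∈Ñ → ε∈Ñ εα≈0) kα))
        in i , j , λ x → begin
          act (t i) (Func.to (h j) x) ≈⟨ act-cong (t i) (≈ᴹ-trans (hj≈k x) (≈ᴹ-sym (ml≈k x))) ⟩
          act (t i) (act (m ++ l) x)  ≈⟨ tml≈f x ⟩
          Func.to f x                 ∎
        where open ≈-Reasoning vectors

-- The three cardinalities and their relation

open import Data.Nat.Base using (_*_)

lemma8p1 : ∀ {c ℓ₁ ℓ₂ v ℓv : Level} (K : OrderedField c ℓ₁ ℓ₂)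
    (E : EuclideanSpace K v ℓv) (Φ : RootSystem E) → Irreducible Φ →
    (Π : SimpleSystem Φ) (α : Fin (SimpleSystem.rank Π)) →
    ∃ λ (n : ℕ) → ∃ λ (a : ℕ) → ∃ λ (b : ℕ) →
    HasCardinality (rootSubset Φ (Φ[_,1] Π α ∩ SameLength Π α)) n ×
    HasCardinality (W[_] Π ｛ α ｝) a ×
    HasCardinality (W[_] Π (Ñ[_] Π α)) b ×
    n * b ≡ a
lemma8p1 K E Φ _ Π α =
  let n , roots  = finite-subset (conjugate? α)
      b , stab = W-finite (Ñ? α)
  -- The order of W_α is taken to be the product itself, as `orbit-stabiliser` counts the group in
  -- that form; the equation is then definitional.
  in n , n * b , b , roots , orbit-stabiliser α roots stab , stab , ≡.refl
  where
  open Words Π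
  open SimpleRoots Π
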